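{- Let $m$ be a positive integer. Every graph $G$ of order at least two with at least $m(|V(G)|-1)+1$ edges has an $m^+$-tree-connected subgraph with at least two vertices.
   Context: Graphs are finite, loopless, and may have multiple edges. A graph is $m$-tree-connected if it contains $m$ pairwise edge-disjoint spanning trees. A graph is $m^+$-tree-connected if it has at least one edge and $G-e$ is $m$-tree-connected for every edge $e$ of $G$. -}

module Defs where

open import Data.Nat using (ℕ; _≤_; _+_; _*_; _∸_)
open import Data.Fin using (Fin)
open import Data.Fin.Subset using (Subset; _∈_; _∉_; _⊆_; _-_; ∣_∣)
open import Data.Product using (_×_; _,_; proj₁; proj₂; Σ; ∃)
open import Data.Sum using (_⊎_)
open import Relation.Binary.PropositionalEquality using (_≡_; _≢_)
open import Relation.Nullary using (¬_)

-- A finite loopless multigraph: vertices Fin V, edges Fin E, each edge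
-- has two (distinct) endpoints.  Parallel edges are allowed.
record Graph : Set where
  field
    V        : ℕ
    E        : ℕ
    ends     : Fin E → Fin V × Fin V
    loopless : (e : Fin E) → proj₁ (ends e) ≢ proj₂ (ends e)
open Graph public

module _ (G : Graph) where

  Joins : Fin (E G) → Fin (V G) → Fin (V G) → Set
  Joins e u w = ends G e ≡ (u , w) ⊎ ends G e ≡ (w , u)

  data Reach (F : Subset (E G)) : Fin (V G) → Fin (V G) → Set where
    here : ∀ {u} → Reach F u u
    step : ∀ {u w x} (e : Fin (E G)) → e ∈ F → Joins e u w →
           Reach F w x → Reach F u x

  EdgesWithin : Subset (V G) → Subset (E G) → Set
  EdgesWithin S F = ∀ e → e ∈ F → proj₁ (ends G e) ∈ S × proj₂ (ends G e) ∈ S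

  IsSubgraph : Subset (V G) → Subset (E G) → Set
  IsSubgraph S F = EdgesWithin S F

  ConnectedOn : Subset (V G) → Subset (E G) → Set
  ConnectedOn S T = ∀ u w → u ∈ S → w ∈ S → Reach T u w

  -- T is acyclic: no edge of T lies on a cycle of T, i.e. the endpoints of
  -- each edge e ∈ T are not joined by a walk in T - e
  Acyclic : Subset (E G) → Set
  Acyclic T = ∀ e → e ∈ T → ¬ Reach (T - e) (proj₁ (ends G e)) (proj₂ (ends G e))

  SpanningTree : Subset (V G) → Subset (E G) → Subset (E G) → Set
  SpanningTree S F T = T ⊆ F × ConnectedOn S T × Acyclic T

  TreeConnected : ℕ → Subset (V G) → Subset (E G) → Set
  TreeConnected m S F =
    Σ (Fin m → Subset (E G)) λ T →
      ((i : Fin m) → SpanningTree S F (T i)) ×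
      (∀ i j → i ≢ j → ∀ e → e ∈ T i → e ∉ T j)

  TreeConnectedPlus : ℕ → Subset (V G) → Subset (E G) → Set
  TreeConnectedPlus m S F =
    (∃ λ e → e ∈ F) × (∀ e → e ∈ F → TreeConnected m S (F - e))

{-# OPTIONS --safe #-}
module Submission where

open import Defs
open import Data.Empty using (⊥-elim)
open import Data.Fin using (Fin; toℕ; fromℕ<) renaming (_≟_ to _≟ᶠ_)
open import Data.Fin.Properties using (all?; ¬∀⟶∃¬; toℕ<n; toℕ-injective)
open import Data.Fin.Subset using (Subset; ∣_∣) renaming (_∈_ to _∈ˢ_; _-_ to _-ˢ_)
open import Data.Fin.Subset.Properties
  using (x∈p∧x≢y⇒x∈p-y; x∈p⇒∣p-x∣<∣p∣; p─q⊆p; p─q─q≡p─q)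
open import Data.List using (List; []; _∷_; _++_; filter; length; map; allFin)
open import Data.List.Membership.Propositional using (_∈_; _∉_; find)
open import Data.List.Membership.Propositional.Properties
  using (∈-++⁺ˡ; ∈-++⁺ʳ; ∈-++⁻; ∈-∃++; ∈-filter⁺; ∈-filter⁻; ∈-allFin; ∈-map⁺; ∈-map⁻)
open import Data.List.Properties using (length-++; length-tabulate)
open import Data.List.Relation.Unary.All using () renaming (lookup to All-lookup; all? to All-all?)
open import Data.List.Relation.Unary.All.Properties using (¬All⇒Any¬; All¬⇒¬Any)
open import Data.List.Relation.Unary.AllPairs using (_∷_)
open import Data.List.Relation.Unary.Any using (here; there)
open import Data.List.Relation.Unary.Unique.Propositional using (Unique)
open import Data.List.Relation.Unary.Unique.Propositional.Properties
  using (allFin⁺) renaming (filter⁺ to Unique-filter⁺)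
open import Data.Nat using (ℕ; zero; suc; _≤_; _<_; _+_; _*_; _∸_; NonZero; z≤n; s≤s; s≤s⁻¹)
open import Data.Nat.Properties
  using (_≟_; ≤-trans; ≤-reflexive; ≤-refl; +-suc; +-comm; +-mono-≤; m≤n⇒m<n∨m≡n; <-irrefl;
         m≤n+m; pred-mono-≤; module ≤-Reasoning)
open import Data.Product using (Σ; ∃; ∃₂; _×_; _,_; proj₁; proj₂)
open import Data.Sum using (_⊎_; inj₁; inj₂; [_,_]′)
open import Data.Vec using (tabulate)
open import Data.Vec.Functional using (updateAt)
open import Data.Vec.Functional.Properties using (updateAt-updates; updateAt-minimal)
open import Data.Vec.Properties using (lookup∘tabulate; lookup⇒[]=; []=⇒lookup)
open import Function using (_∘_; const; id)
open import Level using (0ℓ)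
open import Relation.Binary.Construct.Closure.Equivalence as Eq using (EqClosure)
open import Relation.Binary.Construct.Closure.ReflexiveTransitive using (ε; _◅_; _◅◅_)
open import Relation.Binary.Construct.Closure.Symmetric using (fwd; bwd)
open import Relation.Binary.PropositionalEquality using (_≡_; _≢_; refl; sym; trans; cong; subst)
open import Relation.Nullary using (¬_; Dec; yes; no; does; contradiction)
open import Relation.Nullary.Decidable using (map′; _×-dec_; _⊎-dec_; ¬?; dec-true)
open import Relation.Unary using (Pred; Decidable; _⊆_; _∪_; _∩_; ｛_｝)

-- Add the edges one at a time, keeping an m-colouring of the edges so far with
-- all colour classes forests.  When e₀ is added, consider pairs (e , c) where c
-- colours all edges but e; a swap gives e a colour i and uncolours instead an
-- edge of class i whose removal keeps the ends of e apart in that class.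
-- Starting from e₀, collect such pairs until either some e joins two components
-- of a class, so that everything can be coloured, or no swap uncovers a new edge.
-- In the latter case let A be the set of uncovered edges.  The ends of each
-- uncoloured e are joined inside A by every class, so swaps do not change the
-- connectivity of (class i) ∩ A, which is therefore that of A itself.  Hence, on
-- the component of e₀ in A, each edge e is avoided by m disjoint spanning trees.
-- Finally, m forests have at most m(|V| - 1) edges, so not all of G is coloured.

-- Counting in lists.

module _ {A : Set} where

  delete : ∀ {x : A} {xs} → x ∈ xs →
    ∃ λ ys → length xs ≡ suc (length ys) × (∀ {y} → y ∈ xs → y ≡ x ⊎ y ∈ ys)
  delete {x} x∈xs with ∈-∃++ x∈xs
  ... | ys , zs , refl = ys ++ zs , len , mem
    where
    len : length (ys ++ x ∷ zs) ≡ suc (length (ys ++ zs))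
    len rewrite length-++ ys {x ∷ zs} | length-++ ys {zs} = +-suc _ _
    mem : ∀ {y} → y ∈ ys ++ x ∷ zs → y ≡ x ⊎ y ∈ ys ++ zs
    mem y∈ with ∈-++⁻ ys y∈
    ... | inj₁ y∈ys         = inj₂ (∈-++⁺ˡ y∈ys)
    ... | inj₂ (here y≡x)   = inj₁ y≡x
    ... | inj₂ (there y∈zs) = inj₂ (∈-++⁺ʳ ys y∈zs)

  length-filter-split : ∀ {P : Pred A 0ℓ} (P? : Decidable P) xs →
    length xs ≡ length (filter P? xs) + length (filter (¬? ∘ P?) xs)
  length-filter-split P? [] = refl
  length-filter-split P? (x ∷ xs) with P? x
  ... | yes _ = cong suc (length-filter-split P? xs)
  ... | no _  = trans (cong suc (length-filter-split P? xs)) (sym (+-suc _ _))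

  -- Induction on the number of colours, peeling off the top one. The bound is asked of every
  -- duplicate-free single-coloured list within `xs`, so that it passes to `rest`.
  length-by-colours : ∀ m k (c : A → ℕ) (xs : List A) → Unique xs → (∀ {x} → x ∈ xs → c x < m) →
    (∀ i ys → Unique ys → (∀ {y} → y ∈ ys → y ∈ xs × c y ≡ i) → length ys ≤ k) →
    length xs ≤ m * k
  length-by-colours zero k c [] _ _ _ = z≤n
  length-by-colours zero k c (x ∷ xs) _ c<0 _ with c<0 (here refl)
  ... | ()
  length-by-colours (suc m) k c xs xs! c<1+m bound = begin
    length xs                                         ≡⟨ length-filter-split top? xs ⟩
    length (filter top? xs) + length rest             ≤⟨ +-mono-≤
      (bound m _ (Unique-filter⁺ top? xs!) (∈-filter⁻ top?))
      (length-by-colours m k c rest (Unique-filter⁺ (¬? ∘ top?) xs!) c<m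
        (λ i ys ys! ys⊆ → bound i ys ys! λ y∈ →
          proj₁ (∈-filter⁻ (¬? ∘ top?) (proj₁ (ys⊆ y∈))) , proj₂ (ys⊆ y∈))) ⟩
    k + m * k                                         ∎
    where
    open ≤-Reasoning
    top? : Decidable (λ x → c x ≡ m)
    top? x = c x ≟ m
    rest : List A
    rest = filter (¬? ∘ top?) xs
    c<m : ∀ {x} → x ∈ rest → c x < m
    c<m x∈ with ∈-filter⁻ (¬? ∘ top?) x∈
    ... | x∈xs , cx≢m = [ id , ⊥-elim ∘ cx≢m ]′ (m≤n⇒m<n∨m≡n (s≤s⁻¹ (c<1+m x∈xs)))

-- Finite subsets from decidable predicates.

module _ {n : ℕ} {P : Pred (Fin n) 0ℓ} (P? : Decidable P) where

  toSubset : Subset n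
  toSubset = tabulate (does ∘ P?)

  ∈-toSubset⁺ : ∀ {x} → P x → x ∈ˢ toSubset
  ∈-toSubset⁺ {x} px = lookup⇒[]= x _ (trans (lookup∘tabulate _ x) (dec-true (P? x) px))

  ∈-toSubset⁻ : ∀ {x} → x ∈ˢ toSubset → P x
  ∈-toSubset⁻ {x} x∈ with P? x | trans (sym (lookup∘tabulate (does ∘ P?) x)) ([]=⇒lookup x∈)
  ... | yes px | _ = px
  ... | no _   | ()

-- Removing an element lowers the cardinality, whereas removing `y` a second time changes nothing.
x∈p-y⇒x≢y : ∀ {n} {p : Subset n} {x y} → x ∈ˢ p -ˢ y → x ≢ y
x∈p-y⇒x≢y {p = p} x∈ refl = <-irrefl (cong ∣_∣ (p─q─q≡p─q p _)) (x∈p⇒∣p-x∣<∣p∣ x∈)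

two-elements⇒2≤∣p∣ : ∀ {n} {p : Subset n} {x y} → x ∈ˢ p → y ∈ˢ p → x ≢ y → 2 ≤ ∣ p ∣
two-elements⇒2≤∣p∣ {p = p} x∈p y∈p x≢y =
  ≤-trans (s≤s (≤-trans (s≤s z≤n) (x∈p⇒∣p-x∣<∣p∣ (x∈p∧x≢y⇒x∈p-y y∈p (x≢y ∘ sym)))))
          (x∈p⇒∣p-x∣<∣p∣ x∈p)

-- Connectivity through a set of edges.

module _ (G : Graph) where

  private
    Vertex Edge : Set
    Vertex = Fin (V G)
    Edge = Fin (E G)

    EdgeSet : Set₁
    EdgeSet = Pred Edge 0ℓ

    variable
      P Q : EdgeSet
      x y z : Vertex
      e f : Edge

    open import Data.List.Membership.DecPropositional (_≟ᶠ_ {E G}) using (_∈?_)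

  src tgt : Edge → Vertex
  src = proj₁ ∘ ends G
  tgt = proj₂ ∘ ends G

  data Link (P : EdgeSet) : Vertex → Vertex → Set where
    link : P e → Link P (src e) (tgt e)

  Conn : EdgeSet → Vertex → Vertex → Set
  Conn P = EqClosure (Link P)

  Spans : EdgeSet → Edge → Set
  Spans P e = Conn P (src e) (tgt e)

  edge : P e → Spans P e
  edge = Eq.return ∘ link

  conn-sym : Conn P x y → Conn P y x
  conn-sym = Eq.symmetric _

  conn-bind : P ⊆ Spans Q → Conn P x y → Conn Q x y
  conn-bind {Q = Q} P⊆ = Eq.fold (Eq.isEquivalence (Link Q)) λ { (link p) → P⊆ p }

  conn-mono : P ⊆ Q → Conn P x y → Conn Q x y
  conn-mono P⊆Q = conn-bind (edge ∘ P⊆Q)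

  Via : EdgeSet → Edge → Vertex → Vertex → Set
  Via P e x y = Conn P x (src e) × Conn P (tgt e) y ⊎ Conn P x (tgt e) × Conn P (src e) y

  -- Induction along the walk. If it starts with `e` and the rest crosses `e` again, only `b`, the
  -- part after that crossing, is kept: it leaves from an end of `e`, hence from `x` itself or from
  -- across `e`.
  conn-split : Conn (P ∪ ｛ e ｝) x y → Conn P x y ⊎ Via P e x y
  conn-split ε = inj₁ ε
  conn-split (fwd (link (inj₁ p)) ◅ w) with conn-split w
  ... | inj₁ c              = inj₁ (edge p ◅◅ c)
  ... | inj₂ (inj₁ (a , b)) = inj₂ (inj₁ (edge p ◅◅ a , b))
  ... | inj₂ (inj₂ (a , b)) = inj₂ (inj₂ (edge p ◅◅ a , b))
  conn-split (bwd (link (inj₁ p)) ◅ w) with conn-split w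
  ... | inj₁ c              = inj₁ (conn-sym (edge p) ◅◅ c)
  ... | inj₂ (inj₁ (a , b)) = inj₂ (inj₁ (conn-sym (edge p) ◅◅ a , b))
  ... | inj₂ (inj₂ (a , b)) = inj₂ (inj₂ (conn-sym (edge p) ◅◅ a , b))
  conn-split (fwd (link (inj₂ refl)) ◅ w) with conn-split w
  ... | inj₁ c              = inj₂ (inj₁ (ε , c))
  ... | inj₂ (inj₁ (a , b)) = inj₂ (inj₁ (ε , b))
  ... | inj₂ (inj₂ (a , b)) = inj₁ b
  conn-split (bwd (link (inj₂ refl)) ◅ w) with conn-split w
  ... | inj₁ c              = inj₂ (inj₂ (ε , c))
  ... | inj₂ (inj₁ (a , b)) = inj₁ b
  ... | inj₂ (inj₂ (a , b)) = inj₂ (inj₂ (ε , b))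

  via⇒conn : P ⊆ Q → Spans Q e → Via P e x y → Conn Q x y
  via⇒conn P⊆Q c (inj₁ (a , b)) = conn-mono P⊆Q a ◅◅ c ◅◅ conn-mono P⊆Q b
  via⇒conn P⊆Q c (inj₂ (a , b)) = conn-mono P⊆Q a ◅◅ conn-sym c ◅◅ conn-mono P⊆Q b

  -- A walk through `e` between the ends of `f`, closed up by any connection of these ends in `Q`,
  -- is a closed walk; going round the other way joins the ends of `e`.
  via-flip : P ⊆ Q → Via P e (src f) (tgt f) → Spans Q f → Spans Q e
  via-flip P⊆Q (inj₁ (a , b)) c = conn-sym (conn-mono P⊆Q a) ◅◅ c ◅◅ conn-sym (conn-mono P⊆Q b)
  via-flip P⊆Q (inj₂ (a , b)) c = conn-mono P⊆Q b ◅◅ conn-sym c ◅◅ conn-mono P⊆Q a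

  conn-list? : ∀ L x y → Dec (Conn (_∈ L) x y)
  conn-list? [] x y with x ≟ᶠ y
  ... | yes refl = yes ε
  ... | no x≢y   = no λ { ε → x≢y refl ; (fwd (link ()) ◅ _) ; (bwd (link ()) ◅ _) }
  conn-list? (e ∷ L) x y with conn-list? L x y | conn-list? L x (src e) ×-dec conn-list? L (tgt e) y
                            | conn-list? L x (tgt e) ×-dec conn-list? L (src e) y
  ... | yes c | _     | _     = yes (conn-mono there c)
  ... | no _  | yes v | _     = yes (via⇒conn there (edge (here refl)) (inj₁ v))
  ... | no _  | no _  | yes v = yes (via⇒conn there (edge (here refl)) (inj₂ v))
  ... | no ¬c | no ¬v | no ¬w =
    no ([ ¬c , [ ¬v , ¬w ]′ ]′ ∘ conn-split ∘ conn-mono λ { (here refl) → inj₂ refl ; (there f∈) → inj₁ f∈ })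

  conn? : Decidable P → ∀ x y → Dec (Conn P x y)
  conn? P? x y = map′ (conn-mono (proj₂ ∘ ∈-filter⁻ P? {xs = allFin _}))
                      (conn-mono (∈-filter⁺ P? (∈-allFin _)))
                      (conn-list? (filter P? (allFin _)) x y)

  -- Forests and their size.

  infixl 5 _∖_
  _∖_ : EdgeSet → Edge → EdgeSet
  (P ∖ e) f = P f × f ≢ e

  Forest : EdgeSet → Set
  Forest P = ∀ {e} → P e → ¬ Spans (P ∖ e) e

  forest-antitone : P ⊆ Q → Forest Q → Forest P
  forest-antitone P⊆Q forest p = forest (P⊆Q p) ∘ conn-mono λ (q , ≢) → P⊆Q q , ≢

  -- A new cycle would have to pass through `e`; by `via-flip` its remainder would join the ends of
  -- `e` within `P`.
  forest-insert : Forest P → ¬ Spans P e → Forest (P ∪ ｛ e ｝)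
  forest-insert _ ¬c (inj₂ refl) c =
    ¬c (conn-mono (λ { (inj₁ p , _) → p ; (inj₂ refl , ≢) → contradiction refl ≢ }) c)
  forest-insert {P} {e} forest ¬c {f} (inj₁ p) c =
    [ forest p , (λ v → ¬c (via-flip proj₁ v (edge p))) ]′
      (conn-split (conn-mono (λ { (inj₁ q , ≢) → inj₁ (q , ≢) ; (inj₂ refl , _) → inj₂ refl }) c))

  -- `R` holds one vertex per component. Initially these are all vertices; each edge of a forest
  -- merges two components, and one of their two representatives is dropped.
  forest-representatives : ∀ L → Unique L → Forest (_∈ L) →
    ∃ λ R → length R + length L ≡ V G × (∀ x → ∃ λ r → r ∈ R × Conn (_∈ L) x r)
  forest-representatives [] _ _ =
    allFin (V G) , trans (+-comm _ 0) (length-tabulate id) , λ x → x , ∈-allFin x , ε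
  forest-representatives (e ∷ L) (e∉ ∷ L!) forest
    with forest-representatives L L! (forest-antitone there forest)
  ... | R , len , rep with rep (src e) | rep (tgt e)
  ...   | r , r∈R , s~r | t , t∈R , t~t with delete r∈R
  ...     | R′ , len′ , mem = R′ , trans (trans (+-suc _ _) (cong (_+ length L) (sym len′))) len , rep′
    where
    r≢t : t ≢ r
    r≢t refl = forest (here refl)
      (conn-mono (λ f∈ → there f∈ , λ { refl → All¬⇒¬Any e∉ f∈ }) (s~r ◅◅ conn-sym t~t))
    rep′ : ∀ x → ∃ λ r → r ∈ R′ × Conn (_∈ e ∷ L) x r
    rep′ x with rep x
    ... | q , q∈R , x~q with mem q∈R | mem t∈R
    ...   | inj₂ q∈R′ | _         = q , q∈R′ , conn-mono there x~q
    ...   | inj₁ refl | inj₁ t≡r  = contradiction t≡r r≢t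
    ...   | inj₁ refl | inj₂ t∈R′ = t , t∈R′ ,
      conn-mono there (x~q ◅◅ conn-sym s~r) ◅◅ edge (here refl) ◅◅ conn-mono there t~t

  -- The vertex `x` guarantees at least one representative, which accounts for the `suc`.
  forest-length : ∀ L → Unique L → Forest (_∈ L) → Vertex → suc (length L) ≤ V G
  forest-length L L! forest x with forest-representatives L L! forest
  ... | R , len , rep with rep x
  ...   | r , r∈R , _ with delete r∈R
  ...     | R′ , len′ , _ =
    ≤-trans (s≤s (m≤n+m _ (length R′))) (≤-reflexive (trans (cong (_+ length L) (sym len′)) len))

  -- The edges of `L` are added to `P` one at a time, from the end of the list; `f` is the one that
  -- first joins `x` to `y`, and `B` is the set just before it.
  crossing-edge : Decidable P → ∀ L → ¬ Conn P x y → Conn (P ∪ (_∈ L)) x y →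
    ∃₂ λ f B → f ∈ L × P ⊆ B × B ⊆ (P ∪ (_∈ L)) × ¬ Conn B x y × Conn (B ∪ ｛ f ｝) x y
  crossing-edge P? [] ¬c c = contradiction (conn-mono (λ { (inj₁ p) → p ; (inj₂ ()) }) c) ¬c
  crossing-edge {P} {x} {y} P? (f ∷ L) ¬c c with conn? {P ∪ (_∈ L)} P∪L? x y
    where
    P∪L? : Decidable (P ∪ (_∈ L))
    P∪L? e = P? e ⊎-dec (e ∈? L)
  ... | yes c′ with crossing-edge P? L ¬c c′
  ...   | g , B , g∈ , P⊆B , B⊆ , ¬cB , cB =
    g , B , there g∈ , P⊆B , [ inj₁ , inj₂ ∘ there ]′ ∘ B⊆ , ¬cB , cB
  crossing-edge {P} P? (f ∷ L) ¬c c | no ¬c′ =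
    f , (P ∪ (_∈ L)) , here refl , inj₁ , [ inj₁ , inj₂ ∘ there ]′ , ¬c′ ,
    conn-mono (λ { (inj₁ p)           → inj₁ (inj₁ p)
                 ; (inj₂ (here refl)) → inj₂ refl
                 ; (inj₂ (there f∈))  → inj₁ (inj₂ f∈) }) c

  -- Forest colourings and swaps.

  module _ (m : ℕ) where

    Colouring : Set
    Colouring = Edge → Fin m

    ForestColouring : List Edge → Colouring → Set
    ForestColouring C c = ∀ i → Forest λ f → f ∈ C × c f ≡ i

    Conclusion : Set
    Conclusion = Σ (Subset (V G)) λ S → Σ (Subset (E G)) λ F →
      IsSubgraph G S F × 2 ≤ ∣ S ∣ × TreeConnectedPlus G m S F

    module Exchange (C : List Edge) where

      -- In a state (e , c) the edge e counts as uncoloured: c e is a junk value.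
      State : Set
      State = Edge × Colouring

      Class : State → Fin m → EdgeSet
      Class (e , c) i f = (f ∈ C × f ≢ e) × c f ≡ i

      class? : ∀ s i → Decidable (Class s i)
      class? (e , c) i f = (f ∈? C ×-dec ¬? (f ≟ᶠ e)) ×-dec c f ≟ᶠ i

      Good : State → Set
      Good s = proj₁ s ∈ C × ∀ i → Forest (Class s i)

      -- The edge `p` enters class `i` in place of `e`. The negated condition keeps the class a
      -- forest, and it forces every walk in class `i` between the ends of `p` to use `e`.
      Swap : State → State → Set
      Swap s@(p , c) (e , c′) =
        ∃ λ i → Class s i e × ¬ Spans (Class s i ∖ e) p × c′ ≡ updateAt c p (const i)

      good-swap : ∀ {s t} → Good s → Swap s t → Good t
      good-swap {p , c} {e , _} (p∈C , forest) (i , ((e∈C , e≢p) , ce≡i) , ¬c , refl) = e∈C , forest′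
        where
        s : State
        s = p , c
        forest′ : ∀ j → Forest (Class (e , updateAt c p (const i)) j)
        forest′ j with i ≟ᶠ j
        ... | yes refl = forest-antitone sub (forest-insert (forest-antitone proj₁ (forest i)) ¬c)
          where
          sub : Class (e , updateAt c p (const i)) i ⊆ (Class s i ∖ e) ∪ ｛ p ｝
          sub {f} ((f∈ , f≢e) , eq) with f ≟ᶠ p
          ... | yes refl = inj₂ refl
          ... | no f≢p   = inj₁ (((f∈ , f≢p) , trans (sym (updateAt-minimal f p c f≢p)) eq) , f≢e)
        ... | no i≢j = forest-antitone sub (forest j)
          where
          sub : Class (e , updateAt c p (const i)) j ⊆ Class s j
          sub {f} ((f∈ , f≢e) , eq) with f ≟ᶠ p
          ... | yes refl = contradiction (trans (sym (updateAt-updates p c)) eq) i≢j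
          ... | no f≢p   = (f∈ , f≢p) , trans (sym (updateAt-minimal f p c f≢p)) eq

      augment : ∀ {s} → Good s → ∀ i → ¬ Spans (Class s i) (proj₁ s) → ∃ (ForestColouring C)
      augment {p , c} (p∈C , forest) i ¬c = updateAt c p (const i) , forest′
        where
        forest′ : ForestColouring C (updateAt c p (const i))
        forest′ j with i ≟ᶠ j
        ... | yes refl = forest-antitone sub (forest-insert (forest i) ¬c)
          where
          sub : (λ f → f ∈ C × updateAt c p (const i) f ≡ i) ⊆ Class (p , c) i ∪ ｛ p ｝
          sub {f} (f∈ , eq) with f ≟ᶠ p
          ... | yes refl = inj₂ refl
          ... | no f≢p   = inj₁ ((f∈ , f≢p) , trans (sym (updateAt-minimal f p c f≢p)) eq)
        ... | no i≢j = forest-antitone sub (forest j)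
          where
          sub : (λ f → f ∈ C × updateAt c p (const i) f ≡ j) ⊆ Class (p , c) j
          sub {f} (f∈ , eq) with f ≟ᶠ p
          ... | yes refl = contradiction (trans (sym (updateAt-updates p c)) eq) i≢j
          ... | no f≢p   = (f∈ , f≢p) , trans (sym (updateAt-minimal f p c f≢p)) eq

      -- If class `i` as a whole does not join the ends of `p`, then `p` can receive colour `i`.
      -- Otherwise the class is added edge by edge to its part inside `A`; the edge that first joins
      -- the ends of `p` can be swapped out.
      swap-or-augment : ∀ {s} → Good s → ∀ i A → ¬ Spans (Class s i ∩ (_∈ A)) (proj₁ s) →
        ∃ (ForestColouring C) ⊎ ∃ λ t → Swap s t × proj₁ t ∉ A
      swap-or-augment {s@(p , c)} good i A ¬c with conn? (class? s i) (src p) (tgt p)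
      ... | no ¬c′ = inj₁ (augment good i ¬c′)
      ... | yes c′ with crossing-edge (λ f → class? s i f ×-dec f ∈? A) L ¬c
                          (conn-mono (inj₂ ∘ ∈-filter⁺ (class? s i) (∈-allFin _)) c′)
        where
        L : List Edge
        L = filter (class? s i) (allFin _)
      -- `B` contains the part of the class inside `A`, but not `e`, since adding `e` changes its
      -- connectivity. Hence `e` lies outside `A`.
      ...   | e , B , e∈L , P⊆B , B⊆ , ¬cB , cB =
        inj₂ ((e , updateAt c p (const i)) , (i , e∈class , ¬c∖ , refl) , λ e∈A → e∉B (P⊆B (e∈class , e∈A)))
        where
        e∈class : Class s i e
        e∈class = proj₂ (∈-filter⁻ (class? s i) {xs = allFin _} e∈L)
        e∉B : ¬ B e
        e∉B e∈B = ¬cB (conn-mono (λ { (inj₁ b) → b ; (inj₂ refl) → e∈B }) cB)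
        B⊆∖ : B ⊆ Class s i ∖ e
        B⊆∖ b = [ proj₁ , (λ f∈ → proj₂ (∈-filter⁻ (class? s i) {xs = allFin _} f∈)) ]′ (B⊆ b) ,
                λ { refl → e∉B b }
        -- `B` with `e` joins the ends of `p` only through `e`, so a walk between them avoiding `e`
        -- would close a cycle of class `i` through `e`.
        ¬c∖ : ¬ Spans (Class s i ∖ e) p
        ¬c∖ c∖ = [ ¬cB , (λ v → proj₂ good i e∈class (via-flip B⊆∖ v c∖)) ]′ (conn-split cB)

      -- Families of states linked by swaps.

      data Linked : List State → Set where
        [_] : ∀ s → Linked (s ∷ [])
        -- The newest state comes first and arises by a swap from any earlier one, so the states
        -- form a search tree.
        extend : ∀ {s t W} → t ∈ W → Swap t s → Linked W → Linked (s ∷ W)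

      uncovered : List State → List Edge
      uncovered = map proj₁

      Closed : List Edge → State → Set
      Closed A s = ∀ i → Spans (Class s i ∩ (_∈ A)) (proj₁ s)

      closed? : ∀ A → Decidable (Closed A)
      closed? A s = all? λ i → conn? (λ f → class? s i f ×-dec f ∈? A) _ _

      module _ {A : List Edge} where

        -- Only `e` leaves class `i`. Closedness joins the ends of `p` inside `A`, necessarily
        -- through `e`; reversing the cycle joins the ends of `e` through `p`.
        swap-forth : ∀ {s t} → Swap s t → proj₁ s ∈ C → proj₁ s ∈ A → Closed A s →
          ∀ j → Class s j ∩ (_∈ A) ⊆ Spans (Class t j ∩ (_∈ A))
        swap-forth {p , c} {e , _} (i , ((e∈C , e≢p) , ce≡i) , ¬c , refl) p∈C p∈A closed j
          {f} (((f∈C , f≢p) , cf≡j) , f∈A) with f ≟ᶠ e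
        ... | no f≢e = edge (((f∈C , f≢e) , trans (updateAt-minimal f p c f≢p) cf≡j) , f∈A)
        ... | yes refl with trans (sym ce≡i) cf≡j
        ...   | refl = [ ⊥-elim ∘ ¬c ∘ conn-mono proj₁ , (λ v → via-flip X⊆ v (edge p∈t)) ]′
                         (conn-split (conn-mono ⊆X∪e (closed i)))
          where
          X : EdgeSet
          X = (Class (p , c) i ∖ e) ∩ (_∈ A)
          t : State
          t = e , updateAt c p (const i)
          X⊆ : X ⊆ Class t i ∩ (_∈ A)
          X⊆ {g} ((((g∈ , g≢p) , eq) , g≢e) , g∈A) = ((g∈ , g≢e) , trans (updateAt-minimal g p c g≢p) eq) , g∈A
          p∈t : (Class t i ∩ (_∈ A)) p
          p∈t = ((p∈C , e≢p ∘ sym) , updateAt-updates p c) , p∈A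
          ⊆X∪e : Class (p , c) i ∩ (_∈ A) ⊆ X ∪ ｛ e ｝
          ⊆X∪e {g} (g∈ , g∈A) with g ≟ᶠ e
          ... | yes refl = inj₂ refl
          ... | no g≢e   = inj₁ ((g∈ , g≢e) , g∈A)

        -- Only `p` enters class `i`, and closedness already joins its ends in the old class inside
        -- `A`.
        swap-back : ∀ {s t} → Swap s t → Closed A s →
          ∀ j → Class t j ∩ (_∈ A) ⊆ Spans (Class s j ∩ (_∈ A))
        swap-back {p , c} {e , _} (i , _ , _ , refl) closed j {f} (((f∈C , f≢e) , eq) , f∈A) with f ≟ᶠ p
        ... | no f≢p = edge (((f∈C , f≢p) , trans (sym (updateAt-minimal f p c f≢p)) eq) , f∈A)
        ... | yes refl with trans (sym (updateAt-updates p c)) eq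
        ...   | refl = closed i

        -- Composing swaps along the search tree, in both directions, shows that class `j` inside
        -- `A` has the same connectivity in all states of `W`.
        linked-connectivity : ∀ {W} → Linked W →
          (∀ {s} → s ∈ W → proj₁ s ∈ C × proj₁ s ∈ A × Closed A s) →
          ∀ {s t} → s ∈ W → t ∈ W → ∀ j → Class s j ∩ (_∈ A) ⊆ Spans (Class t j ∩ (_∈ A))
        linked-connectivity [ _ ] _ (here refl) (here refl) j = edge
        linked-connectivity (extend _ _ _) _ (here refl) (here refl) j = edge
        linked-connectivity (extend r∈ swap W) ok (there s∈) (there t∈) j =
          linked-connectivity W (ok ∘ there) s∈ t∈ j
        linked-connectivity (extend r∈ swap W) ok (here refl) (there t∈) j =
          conn-bind (linked-connectivity W (ok ∘ there) r∈ t∈ j) ∘ swap-back swap closed j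
          where closed = proj₂ (proj₂ (ok (there r∈)))
        linked-connectivity (extend r∈ swap W) ok (there s∈) (here refl) j with ok (there r∈)
        ... | r∈C , r∈A , closed =
          conn-bind (swap-forth swap r∈C r∈A closed j) ∘ linked-connectivity W (ok ∘ there) s∈ r∈ j

      -- The subgraph obtained from a closed family.

      module _ (W : List State) (linked : Linked W) (good : ∀ {s} → s ∈ W → Good s)
               (closed : ∀ {s} → s ∈ W → Closed (uncovered W) s) (e₀ : Edge) (e₀∈A : e₀ ∈ uncovered W) where

        A : List Edge
        A = uncovered W

        -- Each edge of `A` is uncoloured in some state `t` of `W`; closedness joins its ends in
        -- class `i` of `t`, and linkedness carries this over to `s`.
        A-conn⇒class-conn : ∀ {s} → s ∈ W → ∀ i → Conn (_∈ A) x y → Conn (Class s i ∩ (_∈ A)) x y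
        A-conn⇒class-conn s∈ i = conn-bind λ f∈A → spans (∈-map⁻ proj₁ f∈A)
          where
          spans : (∃ λ t → t ∈ W × f ≡ proj₁ t) → Spans (Class _ i ∩ (_∈ A)) f
          spans (t , t∈ , refl) = conn-bind
            (linked-connectivity linked (λ r∈ → proj₁ (good r∈) , ∈-map⁺ proj₁ r∈ , closed r∈) t∈ s∈ i) (closed t∈ i)

        InS : Vertex → Set
        InS = Conn (_∈ A) (src e₀)

        inS? : Decidable InS
        inS? = conn? (_∈? A) (src e₀)

        -- Testing the source suffices: both ends of an edge of `A` lie in the same component of
        -- `A`.
        InF : EdgeSet
        InF f = f ∈ A × InS (src f)

        inF? : Decidable InF
        inF? f = f ∈? A ×-dec inS? (src f)

        Tree : State → Fin m → EdgeSet
        Tree s i = Class s i ∩ InF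

        tree? : ∀ s i → Decidable (Tree s i)
        tree? s i f = class? s i f ×-dec inF? f

        -- A walk in `A` that starts in the component never leaves it, so all its edges satisfy
        -- `InF`.
        reach : ∀ {s i} → InS x → Conn (Class s i ∩ (_∈ A)) x y → Reach G (toSubset (tree? s i)) x y
        reach _ ε = here
        reach {s = s} {i} x∈S (fwd (link (f∈ , f∈A)) ◅ w) =
          step _ (∈-toSubset⁺ (tree? s i) (f∈ , f∈A , x∈S)) (inj₁ refl) (reach (x∈S ◅◅ edge f∈A) w)
        reach {s = s} {i} x∈S (bwd (link (f∈ , f∈A)) ◅ w) =
          step _ (∈-toSubset⁺ (tree? s i) (f∈ , f∈A , y∈S)) (inj₂ refl) (reach y∈S w)
          where y∈S = x∈S ◅◅ conn-sym (edge f∈A)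

        spanning-trees : e ∈ A → TreeConnected G m (toSubset inS?) (toSubset inF? -ˢ e)
        spanning-trees e∈A with ∈-map⁻ proj₁ e∈A
        -- A state in which `e` is uncoloured supplies the trees: its classes omit `e` and are
        -- pairwise disjoint.
        ... | s@(e , c) , s∈ , refl = (λ i → toSubset (tree? s i)) , tree , disjoint
          where
          tree : ∀ i → SpanningTree G (toSubset inS?) (toSubset inF? -ˢ e) (toSubset (tree? s i))
          tree i = T⊆F-e , connected , acyclic
            where
            T⊆F-e : ∀ {f} → f ∈ˢ toSubset (tree? s i) → f ∈ˢ toSubset inF? -ˢ e
            T⊆F-e f∈T with ∈-toSubset⁻ (tree? s i) f∈T
            ... | ((_ , f≢e) , _) , f∈F = x∈p∧x≢y⇒x∈p-y (∈-toSubset⁺ inF? f∈F) f≢e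
            connected : ConnectedOn G (toSubset inS?) (toSubset (tree? s i))
            connected x y x∈ y∈ = reach x∈S (A-conn⇒class-conn s∈ i (conn-sym x∈S ◅◅ ∈-toSubset⁻ inS? y∈))
              where x∈S = ∈-toSubset⁻ inS? x∈
            conn : ∀ {f} → Reach G (toSubset (tree? s i) -ˢ f) x y → Conn (Class s i ∖ f) x y
            conn here = ε
            conn (step g g∈ (inj₁ refl) w) =
              edge (proj₁ (∈-toSubset⁻ (tree? s i) (p─q⊆p _ _ g∈)) , x∈p-y⇒x≢y g∈) ◅◅ conn w
            conn (step g g∈ (inj₂ refl) w) =
              conn-sym (edge (proj₁ (∈-toSubset⁻ (tree? s i) (p─q⊆p _ _ g∈)) , x∈p-y⇒x≢y g∈)) ◅◅ conn w
            acyclic : Acyclic G (toSubset (tree? s i))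
            acyclic f f∈ = proj₂ (good s∈) i (proj₁ (∈-toSubset⁻ (tree? s i) f∈)) ∘ conn
          disjoint : ∀ i j → i ≢ j → ∀ f → f ∈ˢ toSubset (tree? s i) → ¬ f ∈ˢ toSubset (tree? s j)
          disjoint i j i≢j f f∈i f∈j with ∈-toSubset⁻ (tree? s i) f∈i | ∈-toSubset⁻ (tree? s j) f∈j
          ... | (_ , cf≡i) , _ | (_ , cf≡j) , _ = i≢j (trans (sym cf≡i) cf≡j)

        closed⇒conclusion : Conclusion
        closed⇒conclusion = toSubset inS? , toSubset inF? , within ,
          two-elements⇒2≤∣p∣ (∈-toSubset⁺ inS? ε) (∈-toSubset⁺ inS? (edge e₀∈A)) (loopless G e₀) ,
          (e₀ , ∈-toSubset⁺ inF? (e₀∈A , ε)) ,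
          λ e e∈F → spanning-trees (proj₁ (∈-toSubset⁻ inF? e∈F))
          where
          within : IsSubgraph G (toSubset inS?) (toSubset inF?)
          within f f∈ with ∈-toSubset⁻ inF? f∈
          ... | f∈A , s∈S = ∈-toSubset⁺ inS? s∈S , ∈-toSubset⁺ inS? (s∈S ◅◅ edge f∈A)

      -- `R` contains every edge not yet uncovered. If the family is not closed and nothing can be
      -- augmented, a swap uncovers a new edge, which is struck from `R`; so the fuel `k` suffices.
      search : ∀ k R → length R ≤ k → ∀ W → Linked W → (∀ {s} → s ∈ W → Good s) →
        ∀ e₀ → e₀ ∈ uncovered W → (∀ f → f ∈ uncovered W ⊎ f ∈ R) → Conclusion ⊎ ∃ (ForestColouring C)
      search k R R≤k W linked good e₀ e₀∈ cover with All-all? (closed? (uncovered W)) W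
      ... | yes closed = inj₁ (closed⇒conclusion W linked good (All-lookup closed) e₀ e₀∈)
      ... | no ¬closed with find (¬All⇒Any¬ (closed? (uncovered W)) W ¬closed)
      ...   | s , s∈ , ¬closed-s
              with ¬∀⟶∃¬ m _ (λ i → conn? (λ f → class? s i f ×-dec f ∈? uncovered W) _ _) ¬closed-s
      ...     | i , ¬c with swap-or-augment (good s∈) i (uncovered W) ¬c
      ...       | inj₁ done = inj₂ done
      ...       | inj₂ (t , swap , t∉) with cover (proj₁ t)
      ...         | inj₁ t∈ = contradiction t∈ t∉
      ...         | inj₂ t∈R with delete t∈R
      -- The new edge lies in `R`, which the bound `zero` makes empty.
      search zero R R≤k W linked good e₀ e₀∈ cover
        | no _ | _ , _ , _ | _ | inj₂ _ | inj₂ _ | R′ , len , _ with ≤-trans (≤-reflexive (sym len)) R≤k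
      ... | ()
      search (suc k) R R≤k W linked good e₀ e₀∈ cover
        | no _ | s , s∈ , _ | _ | inj₂ (t , swap , t∉) | inj₂ _ | R′ , len , mem =
        search k R′ (s≤s⁻¹ (≤-trans (≤-reflexive (sym len)) R≤k)) (t ∷ W) (extend s∈ swap linked)
          (λ { (here refl) → good-swap (good s∈) swap ; (there r∈) → good r∈ }) e₀ (there e₀∈)
          λ f → [ inj₁ ∘ there , (λ f∈R → [ inj₁ ∘ here , inj₂ ]′ (mem f∈R)) ]′ (cover f)

    -- Colouring all edges, and the edge count.

    conclusion-or-colouring : Colouring → ∀ C → Conclusion ⊎ ∃ (ForestColouring C)
    conclusion-or-colouring c₀ [] = inj₂ (c₀ , λ { i (() , _) })
    conclusion-or-colouring c₀ (e ∷ C) with conclusion-or-colouring c₀ C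
    ... | inj₁ done = inj₁ done
    ... | inj₂ (c , forest) =
      -- The search starts from `e` uncoloured; the classes then lie inside those of the forest
      -- colouring `c` of `C`.
      search _ (allFin _) ≤-refl ((e , c) ∷ []) [ _ ] good e (here refl) (λ f → inj₂ (∈-allFin f))
      where
      open Exchange (e ∷ C)
      good : ∀ {s} → s ∈ (e , c) ∷ [] → Good s
      good (here refl) = here refl , λ i → forest-antitone
        (λ { ((here refl , f≢e) , _) → contradiction refl f≢e
           ; ((there f∈ , _) , eq) → f∈ , eq }) (forest i)

    forestColouring-bound : ∀ {c} → Vertex → ForestColouring (allFin (E G)) c → E G ≤ m * (V G ∸ 1)
    forestColouring-bound {c} x forest = subst (_≤ m * (V G ∸ 1)) (length-tabulate id)
      (length-by-colours m (V G ∸ 1) (toℕ ∘ c) (allFin _) (allFin⁺ _) (λ {f} _ → toℕ<n (c f)) bound)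
      where
      bound : ∀ i L → Unique L → (∀ {f} → f ∈ L → f ∈ allFin _ × toℕ (c f) ≡ i) → length L ≤ V G ∸ 1
      bound i [] _ _ = z≤n
      -- The colour `i` is a natural number here; the first edge `f` supplies it as the element
      -- `c f` of `Fin m`.
      bound i L@(f ∷ _) L! L⊆ = pred-mono-≤ (forest-length L L! (forest-antitone
        (λ g∈ → ∈-allFin _ , toℕ-injective (trans (proj₂ (L⊆ g∈)) (sym (proj₂ (L⊆ (here refl)))))) (forest (c f))) x)

theorem2p9 : (m : ℕ) → .{{_ : NonZero m}} → (G : Graph) → 2 ≤ V G →
    m * (V G ∸ 1) + 1 ≤ E G →
    Σ (Subset (V G)) λ S → Σ (Subset (E G)) λ F →
    IsSubgraph G S F × 2 ≤ ∣ S ∣ × TreeConnectedPlus G m S F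
-- Matching on `suc` provides a colour for the constant initial colouring.
theorem2p9 m@(suc _) G 2≤V m[V-1]<E with conclusion-or-colouring G m (λ _ → Fin.zero) (allFin (E G))
... | inj₁ done = done
... | inj₂ (c , forest) = contradiction
  (≤-trans (≤-trans (≤-reflexive (+-comm 1 _)) m[V-1]<E)
           (forestColouring-bound G m (fromℕ< (≤-trans (s≤s z≤n) 2≤V)) forest))
  (<-irrefl refl)
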